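{- Suppose $F(x)=\sum_{n>0} f(n)x^n$ is a generating function, where $f(1)\neq 0$, $F^{\Delta}(n,k)$ is the composita of $F(x)$, and $A(x)=\sum_{n>0}a(n)x^n$ is the generating function which is obtained from the functional equation $A(A(x))=F(x)$. Then for the composita $A^{\Delta}(n,k)$ of the generating function $A(x)$ we have the following recurrent formula: $$ A^{\Delta}(n,k)=\begin{cases} f(1)^{\frac{n}{2}}, & n=k;\\[4pt] \dfrac{1}{f(1)^{\frac{n}{2}}+f(1)^{\frac{k}{2}}}\left(F^{\Delta}(n,k)-\sum\limits_{m=k+1}^{n-1} A^{\Delta}(n,m)A^{\Delta}(m,k)\right), & n>k. \end{cases} $$
   Context: For an ordinary generating function $G(x)=\sum_{n>0}g(n)x^n$ (zero constant term), its composita is the function of two variables $$G^{\Delta}(n,k)=\sum_{\lambda_1+\cdots+\lambda_k=n,\ \lambda_i\ge 1} g(\lambda_1)g(\lambda_2)\cdots g(\lambda_k),$$ the sum being over all compositions of the integer $n$ into exactly $k$ positive parts; equivalently, $[G(x)]^k=\sum_{n\ge k}G^{\Delta}(n,k)x^n$, so $G^{\Delta}(n,k)$ is the coefficient of $x^n$ in $G(x)^k$. $A(A(x))$ denotes the composition of $A$ with itself. An empty sum is $0$.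
   Formalization: f(1)^{1/2} is taken to be the square root equal to a(1) (else F=x, A=-x is a counterexample), and the n>k formula is asserted where its denominator is nonzero (it can vanish, e.g. a(1)=-1, n-k odd); when a(1) and the root are positive in an ordered field, both are proved. -}

module Defs where

open import Algebra.Apartness.Bundles using (HeytingCommutativeRing; HeytingField)
open import Algebra.Bundles using (CommutativeRing)
open import Data.List.Base using (List; []; _∷_; map; concatMap; foldr; upTo)
open import Data.Nat.Base as ℕ using (ℕ; zero; suc; _∸_)
open import Data.Product.Base using (proj₁)
open import Data.Sum.Base using (_⊎_)
open import Data.Vec.Base as Vec using (Vec; []; _∷_)
open import Level using (_⊔_)
open import Relation.Binary.Core using (Rel)
open import Relation.Binary.Structures using (IsStrictPartialOrder)
import Algebra.Properties.Semiring.Exp as SemiringExp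

-- The numbers lo, lo + 1, …, hi; empty when hi < lo.
range : ℕ → ℕ → List ℕ
range lo hi = map (lo ℕ.+_) (upTo (suc hi ∸ lo))

-- All (λ₁ , … , λₖ) with λᵢ ≥ 1 and λ₁ + ⋯ + λₖ = n, each listed once.
compositions : ℕ → (k : ℕ) → List (Vec ℕ k)
compositions zero    zero    = [] ∷ []
compositions (suc _) zero    = []
compositions n       (suc k) =
  concatMap (λ i → map (i ∷_) (compositions (n ∸ i) k)) (range 1 n)

module GeneratingFunctions {c ℓ₁ ℓ₂} (K : HeytingField c ℓ₁ ℓ₂) where

  open HeytingField K
  open CommutativeRing
    (HeytingCommutativeRing.commutativeRing heytingCommutativeRing)
    using (semiring)
  open SemiringExp semiring public using (_^_)

  infix  5 ∑
  infixr 8 _^ₛ_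
  infixl 7 _*ₛ_
  infixr 9 _∘ₛ_

  ∑ : ∀ {a} {X : Set a} → List X → (X → Carrier) → Carrier
  ∑ xs t = foldr (λ x acc → t x + acc) 0# xs

  syntax ∑ xs (λ x → t) = ∑[ x ∈ xs ] t

  -- G n is the coefficient of xⁿ.
  Series : Set c
  Series = ℕ → Carrier

  1ₛ : Series
  1ₛ zero    = 1#
  1ₛ (suc _) = 0#

  _*ₛ_ : Series → Series → Series
  (G *ₛ H) n = ∑[ i ∈ range 0 n ] (G i * H (n ∸ i))

  _^ₛ_ : Series → ℕ → Series
  G ^ₛ zero  = 1ₛ
  G ^ₛ suc k = G *ₛ (G ^ₛ k)

  -- The coefficient of xⁿ in G(H(x)) = Σₖ g(k) H(x)ᵏ.  Stopping at k = n is
  -- correct only if H 0 ≈ 0#, since then H(x)ᵏ has no terms of degree below k.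
  _∘ₛ_ : Series → Series → Series
  (G ∘ₛ H) n = ∑[ k ∈ range 0 n ] (G k * (H ^ₛ k) n)

  composita : Series → ℕ → ℕ → Carrier
  composita G n k =
    ∑[ parts ∈ compositions n k ] Vec.foldr′ _*_ 1# (Vec.map G parts)

  -- #⇒invertible inverts x - 0#, which is ≈ x.
  recip : (x : Carrier) → x # 0# → Carrier
  recip _ x#0 = proj₁ (#⇒invertible x#0)

  -- Apartness is comparability, as for the real numbers; trichotomy is not
  -- required.
  record IsFieldOrder {ℓ₃} (_<_ : Rel Carrier ℓ₃) : Set (c ⊔ ℓ₁ ⊔ ℓ₂ ⊔ ℓ₃) where
    field
      isStrictPartialOrder : IsStrictPartialOrder _≈_ _<_
      #⇒<⊎>                : ∀ {x y} → x # y → x < y ⊎ y < x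
      <⇒#                  : ∀ {x y} → x < y → x # y
      +-monoˡ-<            : ∀ {x y} z → x < y → (x + z) < (y + z)
      *-pos                : ∀ {x y} → 0# < x → 0# < y → 0# < (x * y)

{-# OPTIONS --safe #-}
module Submission where

-- The powers of F = A ∘ A satisfy Fᵏ = (Aᵏ) ∘ A, because G ↦ G ∘ A is
-- multiplicative; comparing coefficients of xⁿ gives
-- F^Δ(n,k) = Σₘ A^Δ(m,k) A^Δ(n,m), where only k ≤ m ≤ n contributes.  The terms
-- m = k and m = n together are (a(1)ⁿ + a(1)ᵏ) A^Δ(n,k).  Multiplicativity
-- follows from G ∘ A = G(0) + A · (tail G ∘ A) by induction on the degree.
-- With a positive root, a(1)² = f(1) and positivity force a(1) = √f(1).

open import Defs
open import Algebra.Apartness.Bundles using (HeytingCommutativeRing; HeytingField)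
open import Algebra.Bundles using (CommutativeRing)
open import Data.List.Base using (List; []; _∷_; _++_; map; concatMap; upTo)
open import Data.List.Properties using (foldr-map; map-upTo)
open import Data.Nat.Base as ℕ using (ℕ; zero; suc; _∸_; z≤n; s≤s; z<s; s<s)
import Data.Nat.Properties as ℕₚ
open import Data.Product.Base using (_×_; _,_; proj₁; proj₂; Σ-syntax)
open import Data.Vec.Base as Vec using (Vec; _∷_)
open import Function.Base using (_∘_)
open import Relation.Binary.Core using (Rel)
open import Relation.Binary.PropositionalEquality.Core as ≡ using (_≡_)
open import Relation.Binary.Structures using (IsStrictPartialOrder)
import Algebra.Apartness.Properties.HeytingCommutativeRing as HeytingProperties
import Algebra.Properties.Group as GroupProperties
import Algebra.Properties.Ring as RingProperties
import Algebra.Properties.Semiring.Exp as SemiringExp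
import Algebra.Solver.Ring.NaturalCoefficients.Default as Solver
import Relation.Binary.Reasoning.Setoid as SetoidReasoning

module _ {c ℓ₁ ℓ₂} (K : HeytingField c ℓ₁ ℓ₂) where

  open HeytingField K
  open GeneratingFunctions K
  open CommutativeRing
    (HeytingCommutativeRing.commutativeRing heytingCommutativeRing)
    using (ring; semiring; commutativeSemiring; +-group)
  open SetoidReasoning setoid
  open Solver commutativeSemiring using (solve; _:=_; _:+_; _:*_)

  private variable
    G H A F : Series

  -- Finite sums over lists and initial segments

  ∑-cong : ∀ {a} {X : Set a} (xs : List X) {s t : X → Carrier} →
           (∀ x → s x ≈ t x) → ∑ xs s ≈ ∑ xs t
  ∑-cong []       s≈t = refl
  ∑-cong (x ∷ xs) s≈t = +-cong (s≈t x) (∑-cong xs s≈t)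

  ∑-0 : ∀ {a} {X : Set a} (xs : List X) → (∑[ x ∈ xs ] 0#) ≈ 0#
  ∑-0 []       = refl
  ∑-0 (x ∷ xs) = trans (+-identityˡ _) (∑-0 xs)

  ∑-+ : ∀ {a} {X : Set a} (xs : List X) (s t : X → Carrier) →
        (∑[ x ∈ xs ] (s x + t x)) ≈ ∑ xs s + ∑ xs t
  ∑-+ []       s t = sym (+-identityˡ 0#)
  ∑-+ (x ∷ xs) s t = trans (+-congˡ (∑-+ xs s t))
    (solve 4 (λ a b c d → (a :+ b) :+ (c :+ d) := (a :+ c) :+ (b :+ d)) refl _ _ _ _)

  *-distribˡ-∑ : ∀ {a} {X : Set a} (y : Carrier) (xs : List X) (t : X → Carrier) →
                 y * ∑ xs t ≈ ∑[ x ∈ xs ] (y * t x)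
  *-distribˡ-∑ y []       t = zeroʳ y
  *-distribˡ-∑ y (x ∷ xs) t = trans (distribˡ y _ _) (+-congˡ (*-distribˡ-∑ y xs t))

  ∑-map : ∀ {a b} {X : Set a} {Y : Set b} (f : X → Y) (xs : List X) (t : Y → Carrier) →
          ∑ (map f xs) t ≡ ∑ xs (t ∘ f)
  ∑-map f xs t = foldr-map _ f 0# xs

  ∑-++ : ∀ {a} {X : Set a} (xs ys : List X) (t : X → Carrier) →
         ∑ (xs ++ ys) t ≈ ∑ xs t + ∑ ys t
  ∑-++ []       ys t = sym (+-identityˡ _)
  ∑-++ (x ∷ xs) ys t = trans (+-congˡ (∑-++ xs ys t)) (sym (+-assoc _ _ _))

  ∑-concatMap : ∀ {a b} {X : Set a} {Y : Set b} (f : X → List Y) (xs : List X)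
                (t : Y → Carrier) → ∑ (concatMap f xs) t ≈ ∑[ x ∈ xs ] ∑ (f x) t
  ∑-concatMap f []       t = refl
  ∑-concatMap f (x ∷ xs) t =
    trans (∑-++ (f x) (concatMap f xs) t) (+-congˡ (∑-concatMap f xs t))

  ∑-range : ∀ lo hi t → ∑ (range lo hi) t ≡ ∑ (upTo (suc hi ∸ lo)) (t ∘ (lo ℕ.+_))
  ∑-range lo hi = ∑-map (lo ℕ.+_) (upTo (suc hi ∸ lo))

  ∑-upTo-suc : ∀ n t → ∑ (upTo (suc n)) t ≡ t 0 + ∑ (upTo n) (t ∘ suc)
  ∑-upTo-suc n t = ≡.cong (t 0 +_)
    (≡.trans (≡.cong (λ xs → ∑ xs t) (≡.sym (map-upTo suc n))) (∑-map suc (upTo n) t))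

  ∑-upTo-cong : ∀ n {s t} → (∀ i → i ℕ.< n → s i ≈ t i) → ∑ (upTo n) s ≈ ∑ (upTo n) t
  ∑-upTo-cong zero    s≈t = refl
  ∑-upTo-cong (suc n) {s} {t} s≈t = begin
    ∑ (upTo (suc n)) s             ≡⟨ ∑-upTo-suc n s ⟩
    s 0 + ∑ (upTo n) (s ∘ suc)     ≈⟨ +-cong (s≈t 0 z<s) (∑-upTo-cong n (λ i i<n → s≈t (suc i) (s<s i<n))) ⟩
    t 0 + ∑ (upTo n) (t ∘ suc)     ≡⟨ ∑-upTo-suc n t ⟨
    ∑ (upTo (suc n)) t             ∎

  ∑-upTo-zero : ∀ n {t} → (∀ i → i ℕ.< n → t i ≈ 0#) → ∑ (upTo n) t ≈ 0#
  ∑-upTo-zero n t≈0 = trans (∑-upTo-cong n t≈0) (∑-0 (upTo n))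

  ∑-upTo-+ : ∀ m n t → ∑ (upTo (m ℕ.+ n)) t ≈ ∑ (upTo m) t + ∑ (upTo n) (t ∘ (m ℕ.+_))
  ∑-upTo-+ zero    n t = sym (+-identityˡ _)
  ∑-upTo-+ (suc m) n t = begin
    ∑ (upTo (suc m ℕ.+ n)) t
      ≡⟨ ∑-upTo-suc (m ℕ.+ n) t ⟩
    t 0 + ∑ (upTo (m ℕ.+ n)) (t ∘ suc)
      ≈⟨ +-congˡ (∑-upTo-+ m n (t ∘ suc)) ⟩
    t 0 + (∑ (upTo m) (t ∘ suc) + ∑ (upTo n) (t ∘ (suc m ℕ.+_)))
      ≈⟨ +-assoc _ _ _ ⟨
    t 0 + ∑ (upTo m) (t ∘ suc) + ∑ (upTo n) (t ∘ (suc m ℕ.+_))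
      ≡⟨ ≡.cong (_+ ∑ (upTo n) (t ∘ (suc m ℕ.+_))) (∑-upTo-suc m t) ⟨
    ∑ (upTo (suc m)) t + ∑ (upTo n) (t ∘ (suc m ℕ.+_))
      ∎

  -- The Cauchy product of power series

  infixl 6 _+ₛ_
  infixl 8 _·ₛ_

  _+ₛ_ : Series → Series → Series
  (G +ₛ H) n = G n + H n

  _·ₛ_ : Carrier → Series → Series
  (x ·ₛ G) n = x * G n

  tail : Series → Series
  tail G n = G (suc n)

  *ₛ-zero : ∀ G H → (G *ₛ H) 0 ≈ G 0 * H 0
  *ₛ-zero G H = +-identityʳ (G 0 * H 0)

  -- From G = G(0) + x · tail G. In this form the degree drops by one while `H` stays fixed, which
  -- is what the inductions on the degree below use.
  *ₛ-suc : ∀ G H n → (G *ₛ H) (suc n) ≈ G 0 * H (suc n) + (tail G *ₛ H) n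
  *ₛ-suc G H n = begin
    (G *ₛ H) (suc n)
      ≡⟨ ∑-range 0 (suc n) t ⟩
    ∑ (upTo (suc (suc n))) t
      ≡⟨ ∑-upTo-suc (suc n) t ⟩
    G 0 * H (suc n) + ∑ (upTo (suc n)) (t ∘ suc)
      ≡⟨ ≡.cong (G 0 * H (suc n) +_) (∑-range 0 n (t ∘ suc)) ⟨
    G 0 * H (suc n) + (tail G *ₛ H) n
      ∎
    where t = λ i → G i * H (suc n ∸ i)

  -- The coefficient of degree n involves `H` only up to degree n. In `∘ₛ-unfold` this lets a
  -- truncated sum be exchanged for a composition.
  *ₛ-cong-≤ : ∀ n {G G′ H H′} → (∀ i → G i ≈ G′ i) → (∀ j → j ℕ.≤ n → H j ≈ H′ j) →
              (G *ₛ H) n ≈ (G′ *ₛ H′) n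
  *ₛ-cong-≤ n G≈G′ H≈H′ =
    ∑-cong (range 0 n) (λ i → *-cong (G≈G′ i) (H≈H′ (n ∸ i) (ℕₚ.m∸n≤m n i)))

  *ₛ-congʳ : ∀ H {G G′} → (∀ i → G i ≈ G′ i) → ∀ n → (G *ₛ H) n ≈ (G′ *ₛ H) n
  *ₛ-congʳ H G≈G′ n = *ₛ-cong-≤ n {H = H} G≈G′ (λ _ _ → refl)

  *ₛ-zeroʳ-≤ : ∀ n G → (∀ j → j ℕ.≤ n → H j ≈ 0#) → (G *ₛ H) n ≈ 0#
  *ₛ-zeroʳ-≤ {H} n G H≈0 = trans
    (∑-cong (range 0 n) (λ i → trans (*-congˡ (H≈0 (n ∸ i) (ℕₚ.m∸n≤m n i))) (zeroʳ (G i))))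
    (∑-0 (range 0 n))

  *ₛ-distribˡ : ∀ G H H′ n → (G *ₛ (H +ₛ H′)) n ≈ (G *ₛ H) n + (G *ₛ H′) n
  *ₛ-distribˡ G H H′ n =
    trans (∑-cong (range 0 n) (λ i → distribˡ _ _ _)) (∑-+ (range 0 n) _ _)

  *ₛ-distribʳ : ∀ H G G′ n → ((G +ₛ G′) *ₛ H) n ≈ (G *ₛ H) n + (G′ *ₛ H) n
  *ₛ-distribʳ H G G′ n =
    trans (∑-cong (range 0 n) (λ i → distribʳ _ _ _)) (∑-+ (range 0 n) _ _)

  *ₛ-·ₛ : ∀ x G H n → (G *ₛ (x ·ₛ H)) n ≈ x * (G *ₛ H) n
  *ₛ-·ₛ x G H n = trans
    (∑-cong (range 0 n) (λ i → solve 3 (λ x g h → g :* (x :* h) := x :* (g :* h)) refl _ _ _))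
    (sym (*-distribˡ-∑ x (range 0 n) _))

  ·ₛ-*ₛ : ∀ x G H n → ((x ·ₛ G) *ₛ H) n ≈ x * (G *ₛ H) n
  ·ₛ-*ₛ x G H n = trans
    (∑-cong (range 0 n) (λ i → *-assoc _ _ _))
    (sym (*-distribˡ-∑ x (range 0 n) _))

  *ₛ-identityˡ : ∀ H n → (1ₛ *ₛ H) n ≈ H n
  *ₛ-identityˡ H zero    = trans (*ₛ-zero 1ₛ H) (*-identityˡ _)
  *ₛ-identityˡ H (suc n) = begin
    (1ₛ *ₛ H) (suc n)                       ≈⟨ *ₛ-suc 1ₛ H n ⟩
    1# * H (suc n) + (tail 1ₛ *ₛ H) n       ≈⟨ +-cong (*-identityˡ _) tail1*H≈0 ⟩
    H (suc n) + 0#                          ≈⟨ +-identityʳ _ ⟩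
    H (suc n)                               ∎
    where
    tail1*H≈0 : (tail 1ₛ *ₛ H) n ≈ 0#
    tail1*H≈0 = trans (∑-cong (range 0 n) (λ i → zeroˡ _)) (∑-0 (range 0 n))

  -- Induction on the degree, for all `G` at once: the tail of `G *ₛ H` is
  -- `G 0 ·ₛ tail H +ₛ tail G *ₛ H`, so the claim recurs at `tail G`.
  *ₛ-assoc : ∀ G H J n → ((G *ₛ H) *ₛ J) n ≈ (G *ₛ (H *ₛ J)) n
  *ₛ-assoc G H J zero = begin
    ((G *ₛ H) *ₛ J) 0       ≈⟨ *ₛ-zero (G *ₛ H) J ⟩
    (G *ₛ H) 0 * J 0        ≈⟨ *-congʳ (*ₛ-zero G H) ⟩
    G 0 * H 0 * J 0         ≈⟨ *-assoc _ _ _ ⟩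
    G 0 * (H 0 * J 0)       ≈⟨ *-congˡ (*ₛ-zero H J) ⟨
    G 0 * (H *ₛ J) 0        ≈⟨ *ₛ-zero G (H *ₛ J) ⟨
    (G *ₛ (H *ₛ J)) 0       ∎
  *ₛ-assoc G H J (suc n) = begin
    ((G *ₛ H) *ₛ J) (suc n)
      ≈⟨ *ₛ-suc (G *ₛ H) J n ⟩
    (G *ₛ H) 0 * J (suc n) + (tail (G *ₛ H) *ₛ J) n
      ≈⟨ +-cong (*-congʳ (*ₛ-zero G H)) (*ₛ-congʳ J (*ₛ-suc G H) n) ⟩
    G 0 * H 0 * J (suc n) + ((G 0 ·ₛ tail H +ₛ tail G *ₛ H) *ₛ J) n
      ≈⟨ +-congˡ (*ₛ-distribʳ J (G 0 ·ₛ tail H) (tail G *ₛ H) n) ⟩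
    G 0 * H 0 * J (suc n) + (((G 0 ·ₛ tail H) *ₛ J) n + ((tail G *ₛ H) *ₛ J) n)
      ≈⟨ +-congˡ (+-cong (·ₛ-*ₛ (G 0) (tail H) J n) (*ₛ-assoc (tail G) H J n)) ⟩
    G 0 * H 0 * J (suc n) + (G 0 * (tail H *ₛ J) n + (tail G *ₛ (H *ₛ J)) n)
      ≈⟨ solve 5 (λ g h j s t → g :* h :* j :+ (g :* s :+ t) := g :* (h :* j :+ s) :+ t) refl _ _ _ _ _ ⟩
    G 0 * (H 0 * J (suc n) + (tail H *ₛ J) n) + (tail G *ₛ (H *ₛ J)) n
      ≈⟨ +-congʳ (*-congˡ (*ₛ-suc H J n)) ⟨
    G 0 * (H *ₛ J) (suc n) + (tail G *ₛ (H *ₛ J)) n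
      ≈⟨ *ₛ-suc G (H *ₛ J) n ⟨
    (G *ₛ (H *ₛ J)) (suc n)
      ∎

  -- By linearity in the second factor. It serves to take the common factor `A` out of a partial sum
  -- of powers of `A`.
  *ₛ-∑ : ∀ {a} {X : Set a} (xs : List X) (y : X → Carrier) G (H : X → Series) n →
         (G *ₛ (λ j → ∑[ x ∈ xs ] (y x * H x j))) n ≈ ∑[ x ∈ xs ] (y x * (G *ₛ H x) n)
  *ₛ-∑ []       y G H n = *ₛ-zeroʳ-≤ n G (λ _ _ → refl)
  *ₛ-∑ (x ∷ xs) y G H n = trans
    (*ₛ-distribˡ G (y x ·ₛ H x) (λ j → ∑[ x ∈ xs ] (y x * H x j)) n)
    (+-cong (*ₛ-·ₛ (y x) G (H x) n) (*ₛ-∑ xs y G H n))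

  -- Compositae as coefficients of powers

  composita-suc : ∀ G n k →
    composita G n (suc k) ≈ ∑[ i ∈ range 1 n ] (G i * composita G (n ∸ i) k)
  composita-suc G n k = begin
    composita G n (suc k)
      ≡⟨ ≡.cong (λ xs → ∑ xs weight) (unfold n) ⟩
    ∑ (concatMap (λ i → map (i ∷_) (compositions (n ∸ i) k)) (range 1 n)) weight
      ≈⟨ ∑-concatMap _ (range 1 n) weight ⟩
    (∑[ i ∈ range 1 n ] ∑ (map (i ∷_) (compositions (n ∸ i) k)) weight)
      ≈⟨ ∑-cong (range 1 n) (λ i → trans
           (reflexive (∑-map (i ∷_) (compositions (n ∸ i) k) weight))
           (sym (*-distribˡ-∑ (G i) (compositions (n ∸ i) k) _))) ⟩
    (∑[ i ∈ range 1 n ] (G i * composita G (n ∸ i) k))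
      ∎
    where
    weight : ∀ {k} → Vec ℕ k → Carrier
    weight parts = Vec.foldr′ _*_ 1# (Vec.map G parts)
    -- Both constructors of `n` are treated so that the clauses of `compositions`, the first two of
    -- which match on `n`, can reduce.
    unfold : ∀ n → compositions n (suc k) ≡
      concatMap (λ i → map (i ∷_) (compositions (n ∸ i) k)) (range 1 n)
    unfold zero    = ≡.refl
    unfold (suc n) = ≡.refl

  -- The first part of a composition corresponds to the first factor of the power. Parts start at 1
  -- but the Cauchy product at 0; the one extra term carries the factor `G 0`, which vanishes.
  composita≈^ₛ : G 0 ≈ 0# → ∀ n k → composita G n k ≈ (G ^ₛ k) n
  composita≈^ₛ G0≈0 zero    zero    = +-identityʳ 1#
  composita≈^ₛ G0≈0 (suc n) zero    = refl
  composita≈^ₛ {G} G0≈0 n   (suc k) = begin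
    composita G n (suc k)
      ≈⟨ composita-suc G n k ⟩
    (∑[ i ∈ range 1 n ] (G i * composita G (n ∸ i) k))
      ≈⟨ ∑-cong (range 1 n) (λ i → *-congˡ (composita≈^ₛ G0≈0 (n ∸ i) k)) ⟩
    ∑ (range 1 n) t
      ≡⟨ ∑-range 1 n t ⟩
    ∑ (upTo n) (t ∘ suc)
      ≈⟨ +-identityˡ _ ⟨
    0# + ∑ (upTo n) (t ∘ suc)
      ≈⟨ +-congʳ (trans (*-congʳ G0≈0) (zeroˡ _)) ⟨
    t 0 + ∑ (upTo n) (t ∘ suc)
      ≡⟨ ∑-upTo-suc n t ⟨
    ∑ (upTo (suc n)) t
      ≡⟨ ∑-range 0 n t ⟨
    (G ^ₛ suc k) n
      ∎
    where t = λ i → G i * (G ^ₛ k) (n ∸ i)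

  -- Powers of, and composition with, a series without constant term

  module _ (A0≈0 : A 0 ≈ 0#) where

    *ₛ-0≈0 : ∀ H → (A *ₛ H) 0 ≈ 0#
    *ₛ-0≈0 H = trans (*ₛ-zero A H) (trans (*-congʳ A0≈0) (zeroˡ _))

    *ₛ-shift : ∀ H n → (A *ₛ H) (suc n) ≈ (tail A *ₛ H) n
    *ₛ-shift H n = trans (*ₛ-suc A H n)
      (trans (+-congʳ (trans (*-congʳ A0≈0) (zeroˡ _))) (+-identityˡ _))

    -- Since A is divisible by x, the coefficient of degree n sees the other factor only in degrees
    -- strictly below n. This strictness is what makes the induction in `∘ₛ-distribʳ-*ₛ` go through.
    *ₛ-cong-< : ∀ n {H H′} → (∀ j → j ℕ.< n → H j ≈ H′ j) → (A *ₛ H) n ≈ (A *ₛ H′) n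
    *ₛ-cong-< zero    {H} {H′} H≈H′ = trans (*ₛ-0≈0 H) (sym (*ₛ-0≈0 H′))
    *ₛ-cong-< (suc n) {H} {H′} H≈H′ = begin
      (A *ₛ H) (suc n)        ≈⟨ *ₛ-shift H n ⟩
      (tail A *ₛ H) n         ≈⟨ *ₛ-cong-≤ n (λ _ → refl) (λ j j≤n → H≈H′ j (s≤s j≤n)) ⟩
      (tail A *ₛ H′) n        ≈⟨ *ₛ-shift H′ n ⟨
      (A *ₛ H′) (suc n)       ∎

    ^ₛ-below : ∀ {n k} → n ℕ.< k → (A ^ₛ k) n ≈ 0#
    ^ₛ-below {zero}  {suc k} n<k = *ₛ-0≈0 (A ^ₛ k)
    ^ₛ-below {suc n} {suc k} (s≤s n<k) = trans (*ₛ-shift (A ^ₛ k) n)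
      (*ₛ-zeroʳ-≤ n (tail A) (λ j j≤n → ^ₛ-below (ℕₚ.≤-<-trans j≤n n<k)))

    -- The leading coefficient of a product is the product of the leading coefficients: as the n-th
    -- power starts in degree n, only one term of the convolution survives.
    ^ₛ-diagonal : ∀ n → (A ^ₛ n) n ≈ A 1 ^ n
    ^ₛ-diagonal zero    = refl
    ^ₛ-diagonal (suc n) = begin
      (A *ₛ A ^ₛ n) (suc n)      ≈⟨ *ₛ-shift (A ^ₛ n) n ⟩
      (tail A *ₛ A ^ₛ n) n       ≈⟨ leading n (λ j → ^ₛ-below) ⟩
      A 1 * (A ^ₛ n) n           ≈⟨ *-congˡ (^ₛ-diagonal n) ⟩
      A 1 * A 1 ^ n              ∎
      where
      leading : ∀ m {H} → (∀ j → j ℕ.< m → H j ≈ 0#) → (tail A *ₛ H) m ≈ A 1 * H m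
      leading zero    {H} H≈0 = *ₛ-zero (tail A) H
      leading (suc m) {H} H≈0 = begin
        (tail A *ₛ H) (suc m)                        ≈⟨ *ₛ-suc (tail A) H m ⟩
        A 1 * H (suc m) + (tail (tail A) *ₛ H) m     ≈⟨ +-congˡ (*ₛ-zeroʳ-≤ m _ (λ j j≤m → H≈0 j (s≤s j≤m))) ⟩
        A 1 * H (suc m) + 0#                         ≈⟨ +-identityʳ _ ⟩
        A 1 * H (suc m)                              ∎

    -- The powers beyond the n-th start above degree n and add nothing. Hence coefficients of
    -- several degrees can share one truncation bound, although `_∘ₛ_` cuts each off at its own
    -- degree.
    ∘ₛ-stable : ∀ G {n N} → n ℕ.< N →
                (∑[ k ∈ upTo N ] (G k * (A ^ₛ k) n)) ≈ (G ∘ₛ A) n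
    ∘ₛ-stable G {n} n<N with d , ≡.refl ← ℕₚ.m≤n⇒∃[o]m+o≡n n<N = begin
      ∑ (upTo (suc n ℕ.+ d)) t
        ≈⟨ ∑-upTo-+ (suc n) d t ⟩
      ∑ (upTo (suc n)) t + ∑ (upTo d) (t ∘ (suc n ℕ.+_))
        ≈⟨ +-congˡ (∑-upTo-zero d (λ i _ →
             trans (*-congˡ (^ₛ-below (s≤s (ℕₚ.m≤m+n n i)))) (zeroʳ _))) ⟩
      ∑ (upTo (suc n)) t + 0#
        ≈⟨ +-identityʳ _ ⟩
      ∑ (upTo (suc n)) t
        ≡⟨ ∑-range 0 n t ⟨
      (G ∘ₛ A) n
        ∎
      where t = λ k → G k * (A ^ₛ k) n

    -- Horner's rule: split off k = 0 and take one factor `A` out of all remaining powers.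
    ∘ₛ-unfold : ∀ G n → (G ∘ₛ A) n ≈ (G 0 ·ₛ 1ₛ +ₛ A *ₛ (tail G ∘ₛ A)) n
    ∘ₛ-unfold G n = begin
      (G ∘ₛ A) n
        -- One term more than the definition has: after k = 0 is removed, n + 1 terms of `tail G`
        -- remain, enough for every degree j ≤ n.
        ≈⟨ ∘ₛ-stable G (ℕₚ.m≤n⇒m≤1+n (ℕₚ.n<1+n n)) ⟨
      ∑ (upTo (suc (suc n))) t
        ≡⟨ ∑-upTo-suc (suc n) t ⟩
      G 0 * 1ₛ n + (∑[ k ∈ upTo (suc n) ] (tail G k * (A *ₛ A ^ₛ k) n))
        ≈⟨ +-congˡ (*ₛ-∑ (upTo (suc n)) (tail G) A (A ^ₛ_) n) ⟨
      G 0 * 1ₛ n + (A *ₛ (λ j → ∑[ k ∈ upTo (suc n) ] (tail G k * (A ^ₛ k) j))) n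
        ≈⟨ +-congˡ (*ₛ-cong-≤ n (λ _ → refl) (λ j j≤n → ∘ₛ-stable (tail G) (s≤s j≤n))) ⟩
      G 0 * 1ₛ n + (A *ₛ (tail G ∘ₛ A)) n
        ∎
      where t = λ k → G k * (A ^ₛ k) n

    ∘ₛ-congʳ : (∀ n → G n ≈ H n) → ∀ n → (G ∘ₛ A) n ≈ (H ∘ₛ A) n
    ∘ₛ-congʳ G≈H n = ∑-cong (range 0 n) (λ k → *-congʳ (G≈H k))

    ∘ₛ-linear : ∀ x G H n → ((x ·ₛ G +ₛ H) ∘ₛ A) n ≈ x * (G ∘ₛ A) n + (H ∘ₛ A) n
    ∘ₛ-linear x G H n = begin
      ((x ·ₛ G +ₛ H) ∘ₛ A) n
        ≈⟨ ∑-cong (range 0 n) (λ k → trans (distribʳ _ _ _) (+-congʳ (*-assoc _ _ _))) ⟩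
      (∑[ k ∈ range 0 n ] (x * (G k * (A ^ₛ k) n) + H k * (A ^ₛ k) n))
        ≈⟨ ∑-+ (range 0 n) _ _ ⟩
      (∑[ k ∈ range 0 n ] (x * (G k * (A ^ₛ k) n))) + (H ∘ₛ A) n
        ≈⟨ +-congʳ (*-distribˡ-∑ x (range 0 n) _) ⟨
      x * (G ∘ₛ A) n + (H ∘ₛ A) n
        ∎

    -- Multiplication by A raises degrees, so the coefficient of xⁿ in
    -- A · ((tail G · H) ∘ A) only involves the claim for tail G below n.
    ∘ₛ-distribʳ-*ₛ : ∀ G H n → ((G *ₛ H) ∘ₛ A) n ≈ ((G ∘ₛ A) *ₛ (H ∘ₛ A)) n
    ∘ₛ-distribʳ-*ₛ G H n = below (suc n) G n (ℕₚ.n<1+n n)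
      where
      H∘A = H ∘ₛ A
      -- `N` bounds the degree and decreases structurally, turning strong induction on n into a
      -- plain one; `G` is quantified because the recursive call is at `tail G`.
      below : ∀ N G n → n ℕ.< N → ((G *ₛ H) ∘ₛ A) n ≈ ((G ∘ₛ A) *ₛ H∘A) n
      below (suc N) G n (s≤s n≤N) = begin
        ((G *ₛ H) ∘ₛ A) n
          ≈⟨ ∘ₛ-unfold (G *ₛ H) n ⟩
        (G *ₛ H) 0 * 1ₛ n + (A *ₛ (tail (G *ₛ H) ∘ₛ A)) n
          ≈⟨ +-cong (*-congʳ (*ₛ-zero G H)) (*ₛ-cong-< n step) ⟩
        G 0 * H 0 * 1ₛ n + (A *ₛ (G 0 ·ₛ (tail H ∘ₛ A) +ₛ (tail G ∘ₛ A) *ₛ H∘A)) n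
          ≈⟨ +-congˡ (*ₛ-distribˡ A (G 0 ·ₛ (tail H ∘ₛ A)) ((tail G ∘ₛ A) *ₛ H∘A) n) ⟩
        G 0 * H 0 * 1ₛ n +
          ((A *ₛ (G 0 ·ₛ (tail H ∘ₛ A))) n + (A *ₛ ((tail G ∘ₛ A) *ₛ H∘A)) n)
          ≈⟨ +-congˡ (+-cong (*ₛ-·ₛ (G 0) A (tail H ∘ₛ A) n)
               (sym (*ₛ-assoc A (tail G ∘ₛ A) H∘A n))) ⟩
        G 0 * H 0 * 1ₛ n +
          (G 0 * (A *ₛ (tail H ∘ₛ A)) n + ((A *ₛ (tail G ∘ₛ A)) *ₛ H∘A) n)
          ≈⟨ solve 5 (λ g h i s t → g :* h :* i :+ (g :* s :+ t) := g :* (h :* i :+ s) :+ t) refl _ _ _ _ _ ⟩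
        G 0 * (H 0 * 1ₛ n + (A *ₛ (tail H ∘ₛ A)) n) + ((A *ₛ (tail G ∘ₛ A)) *ₛ H∘A) n
          -- The bracket is `H∘A` unfolded; writing it as `1ₛ *ₛ H∘A` gives both summands the right
          -- factor `H∘A`, which can then be taken out.
          ≈⟨ +-congʳ (*-congˡ (trans (*ₛ-identityˡ H∘A n) (∘ₛ-unfold H n))) ⟨
        G 0 * (1ₛ *ₛ H∘A) n + ((A *ₛ (tail G ∘ₛ A)) *ₛ H∘A) n
          ≈⟨ +-congʳ (·ₛ-*ₛ (G 0) 1ₛ H∘A n) ⟨
        ((G 0 ·ₛ 1ₛ) *ₛ H∘A) n + ((A *ₛ (tail G ∘ₛ A)) *ₛ H∘A) n
          ≈⟨ *ₛ-distribʳ H∘A (G 0 ·ₛ 1ₛ) (A *ₛ (tail G ∘ₛ A)) n ⟨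
        ((G 0 ·ₛ 1ₛ +ₛ A *ₛ (tail G ∘ₛ A)) *ₛ H∘A) n
          ≈⟨ *ₛ-congʳ H∘A (∘ₛ-unfold G) n ⟨
        ((G ∘ₛ A) *ₛ H∘A) n
          ∎
        where
        step : ∀ j → j ℕ.< n → (tail (G *ₛ H) ∘ₛ A) j ≈
               (G 0 ·ₛ (tail H ∘ₛ A) +ₛ (tail G ∘ₛ A) *ₛ H∘A) j
        step j j<n = begin
          (tail (G *ₛ H) ∘ₛ A) j
            ≈⟨ ∘ₛ-congʳ (*ₛ-suc G H) j ⟩
          ((G 0 ·ₛ tail H +ₛ tail G *ₛ H) ∘ₛ A) j
            ≈⟨ ∘ₛ-linear (G 0) (tail H) (tail G *ₛ H) j ⟩
          G 0 * (tail H ∘ₛ A) j + ((tail G *ₛ H) ∘ₛ A) j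
            ≈⟨ +-congˡ (below N (tail G) j (ℕₚ.<-≤-trans j<n n≤N)) ⟩
          G 0 * (tail H ∘ₛ A) j + ((tail G ∘ₛ A) *ₛ H∘A) j
            ∎

    ∘ₛ-1ₛ : ∀ n → (1ₛ ∘ₛ A) n ≈ 1ₛ n
    ∘ₛ-1ₛ n = begin
      (1ₛ ∘ₛ A) n                             ≡⟨ ∑-range 0 n t ⟩
      ∑ (upTo (suc n)) t                      ≡⟨ ∑-upTo-suc n t ⟩
      1# * 1ₛ n + ∑ (upTo n) (t ∘ suc)        ≈⟨ +-cong (*-identityˡ _) (∑-upTo-zero n (λ _ _ → zeroˡ _)) ⟩
      1ₛ n + 0#                               ≈⟨ +-identityʳ _ ⟩
      1ₛ n                                    ∎
      where t = λ k → 1ₛ k * (A ^ₛ k) n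

    ^ₛ-∘ₛ : (∀ n → (G ∘ₛ A) n ≈ F n) → ∀ k n → ((G ^ₛ k) ∘ₛ A) n ≈ (F ^ₛ k) n
    ^ₛ-∘ₛ G∘A≈F zero n = ∘ₛ-1ₛ n
    ^ₛ-∘ₛ {G} {F} G∘A≈F (suc k) n = begin
      ((G *ₛ G ^ₛ k) ∘ₛ A) n              ≈⟨ ∘ₛ-distribʳ-*ₛ G (G ^ₛ k) n ⟩
      ((G ∘ₛ A) *ₛ ((G ^ₛ k) ∘ₛ A)) n     ≈⟨ *ₛ-cong-≤ n G∘A≈F (λ j _ → ^ₛ-∘ₛ G∘A≈F k j) ⟩
      (F *ₛ F ^ₛ k) n                     ∎

    -- The terms with m < k vanish. At m = k and m = n one factor is a leading coefficient, a power
    -- of a(1), and the other is the coefficient of degree n in the k-th power. Writing n as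
    -- `suc (k ℕ.+ d)` makes the number `d` of terms strictly between explicit.
    ^ₛ-∘ₛ-split : ∀ k d → let n = suc (k ℕ.+ d) in ((A ^ₛ k) ∘ₛ A) n ≈
      (A 1 ^ n + A 1 ^ k) * (A ^ₛ k) n +
      ∑ (range (suc k) (n ∸ 1)) (λ m → (A ^ₛ m) n * (A ^ₛ k) m)
    ^ₛ-∘ₛ-split k d = begin
      ((A ^ₛ k) ∘ₛ A) n
        ≡⟨ ∑-range 0 n t ⟩
      ∑ (upTo (suc n)) t
        -- The count is arranged as k vanishing terms, one for m = k, d in the middle and one for m
        -- = n.
        ≡⟨ ≡.cong (λ m → ∑ (upTo m) t) suc-n≡ ⟩
      ∑ (upTo (k ℕ.+ suc (d ℕ.+ 1))) t
        ≈⟨ ∑-upTo-+ k (suc (d ℕ.+ 1)) t ⟩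
      ∑ (upTo k) t + ∑ (upTo (suc (d ℕ.+ 1))) (t ∘ (k ℕ.+_))
        ≈⟨ +-congʳ (∑-upTo-zero k (λ i i<k → trans (*-congʳ (^ₛ-below i<k)) (zeroˡ _))) ⟩
      0# + ∑ (upTo (suc (d ℕ.+ 1))) (t ∘ (k ℕ.+_))
        ≈⟨ +-identityˡ _ ⟩
      ∑ (upTo (suc (d ℕ.+ 1))) (t ∘ (k ℕ.+_))
        ≡⟨ ∑-upTo-suc (d ℕ.+ 1) (t ∘ (k ℕ.+_)) ⟩
      t (k ℕ.+ 0) + ∑ (upTo (d ℕ.+ 1)) (λ i → t (k ℕ.+ suc i))
        ≈⟨ +-cong (reflexive (≡.cong t (ℕₚ.+-identityʳ k)))
             (∑-cong (upTo (d ℕ.+ 1)) (λ i → reflexive (≡.cong t (ℕₚ.+-suc k i)))) ⟩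
      t k + ∑ (upTo (d ℕ.+ 1)) (t ∘ (suc k ℕ.+_))
        ≈⟨ +-congˡ (∑-upTo-+ d 1 (t ∘ (suc k ℕ.+_))) ⟩
      t k + (∑ (upTo d) (t ∘ (suc k ℕ.+_)) + (t (suc k ℕ.+ (d ℕ.+ 0)) + 0#))
        -- The length `n ∸ suc k` of the middle range reduces to `(k ℕ.+ d) ∸ k`, which is `d`.
        ≈⟨ +-congˡ (+-cong
             (reflexive (≡.cong (λ m → ∑ (upTo m) (t ∘ (suc k ℕ.+_))) (≡.sym (ℕₚ.m+n∸m≡n k d))))
             (trans (+-identityʳ _)
               (reflexive (≡.cong (λ m → t (suc k ℕ.+ m)) (ℕₚ.+-identityʳ d))))) ⟩
      t k + (∑ (upTo (n ∸ suc k)) (t ∘ (suc k ℕ.+_)) + t n)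
        ≡⟨ ≡.cong (λ s → t k + (s + t n)) (∑-range (suc k) (k ℕ.+ d) t) ⟨
      t k + (∑ (range (suc k) (k ℕ.+ d)) t + t n)
        ≈⟨ +-cong (*-congʳ (^ₛ-diagonal k))
             (+-cong (∑-cong (range (suc k) (k ℕ.+ d)) (λ m → *-comm _ _))
                     (*-congˡ (^ₛ-diagonal n))) ⟩
      A 1 ^ k * (A ^ₛ k) n + (rest + (A ^ₛ k) n * A 1 ^ n)
        ≈⟨ solve 4 (λ p q x r → p :* x :+ (r :+ x :* q) := (q :+ p) :* x :+ r) refl _ _ _ _ ⟩
      (A 1 ^ n + A 1 ^ k) * (A ^ₛ k) n + rest
        ∎
      where
      n = suc (k ℕ.+ d)
      t = λ m → (A ^ₛ k) m * (A ^ₛ m) n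
      rest = ∑ (range (suc k) (n ∸ 1)) (λ m → (A ^ₛ m) n * (A ^ₛ k) m)
      suc-n≡ : suc n ≡ k ℕ.+ suc (d ℕ.+ 1)
      suc-n≡ = ≡.sym (≡.trans (ℕₚ.+-suc k (d ℕ.+ 1))
        (≡.cong suc (≡.trans (≡.cong (k ℕ.+_) (ℕₚ.+-comm d 1)) (ℕₚ.+-suc k d))))

  -- Division and uniqueness of square roots

  recip-unique : ∀ {x y z} (x#0 : x # 0#) → x * y ≈ z → y ≈ recip x x#0 * z
  recip-unique {x} {y} {z} x#0 xy≈z = begin
    y                       ≈⟨ *-identityˡ y ⟨
    1# * y                  ≈⟨ *-congʳ (proj₁ (proj₂ (#⇒invertible x#0))) ⟨
    r * (x - 0#) * y        ≈⟨ *-congʳ (*-congˡ (x-0≈x x)) ⟩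
    r * x * y               ≈⟨ *-assoc _ _ _ ⟩
    r * (x * y)             ≈⟨ *-congˡ xy≈z ⟩
    r * z                   ∎
    where
    open HeytingProperties heytingCommutativeRing using (x-0≈x)
    r = recip x x#0

  #0∧*≈0⇒≈0 : ∀ {x y} → x # 0# → x * y ≈ 0# → y ≈ 0#
  #0∧*≈0⇒≈0 x#0 xy≈0 = trans (recip-unique x#0 xy≈0) (zeroʳ _)

  -- In (x + y)(x - y) = x² - y² = 0 the first factor is invertible, so the second is zero. This
  -- excludes the opposite sign of the root.
  squares-≈ : ∀ {x y} → x + y # 0# → x * x ≈ y * y → x ≈ y
  squares-≈ {x} {y} x+y#0 x²≈y² = x∙y⁻¹≈ε⇒x≈y x y (#0∧*≈0⇒≈0 x+y#0 (begin
    (x + y) * (x - y)                          ≈⟨ distribˡ _ _ _ ⟩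
    (x + y) * x + (x + y) * - y                ≈⟨ +-congˡ (-‿distribʳ-* (x + y) y) ⟨
    (x + y) * x - (x + y) * y                  ≈⟨ x≈y⇒x∙y⁻¹≈ε (begin
      (x + y) * x                                ≈⟨ distribʳ _ _ _ ⟩
      x * x + y * x                              ≈⟨ +-cong x²≈y² (*-comm y x) ⟩
      y * y + x * y                              ≈⟨ +-comm _ _ ⟩
      x * y + y * y                              ≈⟨ distribʳ _ _ _ ⟨
      (x + y) * y                                ∎) ⟩
    0#                                         ∎))
    where
    open GroupProperties +-group using (x∙y⁻¹≈ε⇒x≈y; x≈y⇒x∙y⁻¹≈ε)
    open RingProperties ring using (-‿distribʳ-*)

  -- Positivity in an ordered field

  module _ {ℓ₃} {_<_ : Rel Carrier ℓ₃} (isFieldOrder : IsFieldOrder _<_) where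

    open IsFieldOrder isFieldOrder
    open IsStrictPartialOrder isStrictPartialOrder
      using (<-respʳ-≈; <-respˡ-≈) renaming (trans to <-trans)

    +-pos : ∀ {x y} → 0# < x → 0# < y → 0# < (x + y)
    +-pos {x} {y} 0<x 0<y =
      <-trans 0<y (<-respˡ-≈ (+-identityˡ y) (+-monoˡ-< y 0<x))

    -- The induction starts at exponent 1, where the claim is `0<x` itself; the exponents in the
    -- theorem are all at least 1.
    ^-pos : ∀ {x} → 0# < x → ∀ n → 1 ℕ.≤ n → 0# < (x ^ n)
    ^-pos 0<x 1             _ = <-respʳ-≈ (sym (*-identityʳ _)) 0<x
    ^-pos 0<x (suc (suc n)) _ = *-pos 0<x (^-pos 0<x (suc n) (s≤s z≤n))

    pos⇒#0 : ∀ {x} → 0# < x → x # 0#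
    pos⇒#0 0<x = #-sym (<⇒# 0<x)

  -- The functional equation and the recurrence

  module _ (A0≈0 : A 0 ≈ 0#) (F0≈0 : F 0 ≈ 0#) (A∘A≈F : ∀ n → (A ∘ₛ A) n ≈ F n) where

    -- Linear coefficients multiply under composition. The equation leaves the sign of a(1) open, so
    -- the lemmas after it are stated for the root that equals a(1).
    A₁²≈F₁ : A 1 * A 1 ≈ F 1
    A₁²≈F₁ = begin
      A 1 * A 1                          ≈⟨ *-congˡ (trans (^ₛ-diagonal {A} A0≈0 1) (*-identityʳ _)) ⟨
      A 1 * (A ^ₛ 1) 1                   ≈⟨ +-identityˡ _ ⟨
      0# + A 1 * (A ^ₛ 1) 1              ≈⟨ +-cong (zeroʳ (A 0)) (+-identityʳ _) ⟨
      A 0 * 0# + (A 1 * (A ^ₛ 1) 1 + 0#) ≈⟨ A∘A≈F 1 ⟩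
      F 1                                ∎

    module _ {√f₁ : Carrier} (A₁≈√f₁ : A 1 ≈ √f₁) where

      open SemiringExp semiring using (^-congˡ)

      composita-diagonal : ∀ n → composita A n n ≈ √f₁ ^ n
      composita-diagonal n = trans (composita≈^ₛ A0≈0 n n)
        (trans (^ₛ-diagonal A0≈0 n) (^-congˡ n A₁≈√f₁))

      -- The coefficient of degree n in the k-th power of F, expanded through A, is a linear
      -- equation for `composita A n k`; the denominator is its coefficient.
      composita-recurrence : ∀ n k → k ℕ.< n → (nz : √f₁ ^ n + √f₁ ^ k # 0#) →
        composita A n k ≈
          recip (√f₁ ^ n + √f₁ ^ k) nz *
          (composita F n k -
            (∑[ m ∈ range (suc k) (n ∸ 1) ] (composita A n m * composita A m k)))
      composita-recurrence n k k<n nz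
        with d , ≡.refl ← ℕₚ.m≤n⇒∃[o]m+o≡n k<n = recip-unique nz (begin
          (√f₁ ^ n + √f₁ ^ k) * composita A n k
            -- The middle sum is moved to the other side of the expansion of `composita F n k`.
            ≈⟨ x≈z//y _ _ _ (sym (begin
              composita F n k
                ≈⟨ composita≈^ₛ F0≈0 n k ⟩
              (F ^ₛ k) n
                ≈⟨ ^ₛ-∘ₛ A0≈0 A∘A≈F k n ⟨
              ((A ^ₛ k) ∘ₛ A) n
                ≈⟨ ^ₛ-∘ₛ-split A0≈0 k d ⟩
              (A 1 ^ n + A 1 ^ k) * (A ^ₛ k) n +
                ∑ (range (suc k) (n ∸ 1)) (λ m → (A ^ₛ m) n * (A ^ₛ k) m)
                ≈⟨ +-cong
                     (*-cong (+-cong (^-congˡ n A₁≈√f₁) (^-congˡ k A₁≈√f₁))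
                             (sym (composita≈^ₛ A0≈0 n k)))
                     (∑-cong (range (suc k) (n ∸ 1)) (λ m → *-cong
                       (sym (composita≈^ₛ A0≈0 n m)) (sym (composita≈^ₛ A0≈0 m k)))) ⟩
              (√f₁ ^ n + √f₁ ^ k) * composita A n k + rest
                ∎)) ⟩
          composita F n k - rest
            ∎)
        where
        open GroupProperties +-group using (x≈z//y)
        rest = ∑[ m ∈ range (suc k) (n ∸ 1) ] (composita A n m * composita A m k)

theorem3 :
  ∀ {c ℓ₁ ℓ₂ ℓ₃} (K : HeytingField c ℓ₁ ℓ₂) →
  let open HeytingField K
      open GeneratingFunctions K
  in
  (F A : Series) → F 0 ≈ 0# → A 0 ≈ 0# → F 1 # 0# →
  (∀ n → (A ∘ₛ A) n ≈ F n) →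
  -- √f₁ ^ n is f(1)^(n/2)
  (√f₁ : Carrier) → √f₁ * √f₁ ≈ F 1 →
  -- any square root: √f₁ is the one equal to a(1), and division needs a nonzero denominator
  ( A 1 ≈ √f₁ →
    (∀ n → 1 ℕ.≤ n → composita A n n ≈ √f₁ ^ n)
    ×
    (∀ n k → 1 ℕ.≤ k → k ℕ.< n →
      (nz : √f₁ ^ n + √f₁ ^ k # 0#) →
      composita A n k ≈
        recip (√f₁ ^ n + √f₁ ^ k) nz *
        (composita F n k -
          (∑[ m ∈ range (suc k) (n ∸ 1) ] (composita A n m * composita A m k)))) )
  ×
  -- positive square root in an ordered field: denominators never vanish
  ( (_<_ : Rel Carrier ℓ₃) → IsFieldOrder _<_ → 0# < √f₁ → 0# < A 1 →
    (∀ n → 1 ℕ.≤ n → composita A n n ≈ √f₁ ^ n)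
    ×
    (∀ n k → 1 ℕ.≤ k → k ℕ.< n →
      Σ[ nz ∈ √f₁ ^ n + √f₁ ^ k # 0# ]
      composita A n k ≈
        recip (√f₁ ^ n + √f₁ ^ k) nz *
        (composita F n k -
          (∑[ m ∈ range (suc k) (n ∸ 1) ] (composita A n m * composita A m k)))) )
theorem3 K F A F0≈0 A0≈0 _ A∘A≈F √f₁ √f₁²≈F₁ =
  (λ A₁≈√f₁ →
    (λ n _ → composita-diagonal K A0≈0 F0≈0 A∘A≈F A₁≈√f₁ n) ,
    (λ n k _ → composita-recurrence K A0≈0 F0≈0 A∘A≈F A₁≈√f₁ n k)) ,
  λ _<_ isFieldOrder 0<√f₁ 0<A₁ →
    -- a(1) and `√f₁` both square to f(1), and their sum is positive, hence apart from zero.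
    let A₁≈√f₁ = squares-≈ K
          (pos⇒#0 K isFieldOrder (+-pos K isFieldOrder 0<A₁ 0<√f₁))
          (trans (A₁²≈F₁ K A0≈0 F0≈0 A∘A≈F) (sym √f₁²≈F₁))
    in
    (λ n _ → composita-diagonal K A0≈0 F0≈0 A∘A≈F A₁≈√f₁ n) ,
    λ n k 1≤k k<n →
      -- The denominator is a sum of two positive powers; 1 ≤ k < n puts both exponents in the scope
      -- of `^-pos`.
      let nz = pos⇒#0 K isFieldOrder (+-pos K isFieldOrder
                 (^-pos K isFieldOrder 0<√f₁ n (ℕₚ.≤-trans 1≤k (ℕₚ.<⇒≤ k<n)))
                 (^-pos K isFieldOrder 0<√f₁ k 1≤k))
      in nz , composita-recurrence K A0≈0 F0≈0 A∘A≈F A₁≈√f₁ n k k<n nz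
  where open HeytingField K using (sym; trans)
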